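{- Let $R$ be a commutative ring with unity, let $m\ge1$ be an integer, let $n\in\mathbb N$, and let $\lambda_1:\mathbb N\times\mathbb Z\to R$ have triangular support of order $m$. Suppose that, for this fixed $n$, there exist coefficients $\lambda_3(n,k)\in R$ ($0\le k\le w_m(n)$) satisfying: (a) $\displaystyle\sum_{b=0}^{t}\lambda_3(n,b)\,\lambda_1(n-mb,t-b)=0$ for all $1\le t\le w_m(n)$; (b) $\lambda_1(n,0)\,\lambda_3(n,0)=1$; (c) $\lambda_1(n-im,0)\in R^\times$ for all $1\le i\le w_m(n)$. Then, for each $1\le k\le w_m(n)$, $$\lambda_3(n,k)=(-1)^k\,\frac{\det A_k}{\prod_{i=0}^{k}\lambda_1(n-im,0)},$$ where $A_k=(a_{ij})_{1\le i,j\le k}$ is the $k\times k$ lower Hessenberg matrix with entries $a_{ij}=\lambda_1\bigl(n-(j-1)m,\,i-j+1\bigr)$ if $j\le i+1$ and $a_{ij}=0$ if $j>i+1$, that is, $$A_k=\begin{bmatrix} \lambda_1(n,1)&\lambda_1(n-m,0)&0&\cdots&0\\ \lambda_1(n,2)&\lambda_1(n-m,1)&\lambda_1(n-2m,0)&\cdots&0\\ \lambda_1(n,3)&\lambda_1(n-m,2)&\lambda_1(n-2m,1)&\ddots&\vdots\\ \vdots&\vdots&\vdots&\ddots&\lambda_1(n-(k-1)m,0)\\ \lambda_1(n,k)&\lambda_1(n-m,k-1)&\lambda_1(n-2m,k-2)&\cdots&\lambda_1(n-(k-1)m,1) \end{bmatrix}.$$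
   Context: $\mathbb N=\{0,1,2,\dots\}$, $w_m(n)=\lfloor n/m\rfloor$, and $R^\times$ is the group of units of $R$. A family $\lambda:\mathbb N\times\mathbb Z\to R$ has triangular support of order $m$ if $\lambda(n,k)=0$ whenever $k<0$ or $k>w_m(n)$. Division by a unit $u$ of $R$ means multiplication by $u^{ -1}$. -}

module Defs where

open import Algebra.Bundles using (CommutativeRing; Semiring)
import Algebra.Definitions
import Algebra.Definitions.RawSemiring as RawSemiringDefs
import Algebra.Properties.Semiring.Sum as SemiringSum
open import Data.Fin.Base using (Fin; zero; suc; toℕ)
open import Data.Integer.Base as ℤ using (ℤ; +_)
open import Data.Nat.Base as ℕ using (ℕ; zero; suc; NonZero)
import Data.Nat.Properties as ℕ using (_≤?_)
open import Data.Product.Base using (proj₁)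
open import Data.Sum.Base using (_⊎_)
open import Data.Vec.Functional using (Vector; removeAt)
open import Level using (_⊔_)
open import Relation.Nullary.Decidable using (yes; no)

w : (m : ℕ) .{{_ : NonZero m}} → ℕ → ℕ
w m n = n ℕ./ m

module RingDefs {c ℓ} (R : CommutativeRing c ℓ) where

  open CommutativeRing R hiding (zero)
  open Algebra.Definitions _≈_ using (Invertible)
  open RawSemiringDefs (Semiring.rawSemiring semiring) public using (_^_; product)
  open SemiringSum semiring public using (sum⁺-syntax)

  -- ∏[ i ≤ n ] x ranges over 0 ≤ i ≤ n; the index i has type Fin (suc n),
  -- as it does in the library's ∑[ i ≤ n ] x.
  infixl 10 ∏⁺-syntax

  ∏⁺-syntax : ∀ n → Vector Carrier (suc n) → Carrier
  ∏⁺-syntax _ = product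

  syntax ∏⁺-syntax n (λ i → x) = ∏[ i ≤ n ] x

  IsUnit : Carrier → Set (c ⊔ ℓ)
  IsUnit = Invertible 1# _*_

  infixl 7 _÷_[_]

  _÷_[_] : Carrier → (u : Carrier) → IsUnit u → Carrier
  x ÷ u [ unit ] = x * proj₁ unit

  Matrix : ℕ → Set c
  Matrix k = Fin k → Fin k → Carrier

  -- Cofactor expansion along the first row; the determinant of the 0 × 0
  -- matrix is 1.  Indices are zero-based, so the sign at column j is (-1)^j.
  det : ∀ {k} → Matrix k → Carrier
  det {zero}  M = 1#
  det {suc k} M =
    ∑[ j ≤ k ] ((- 1#) ^ toℕ j * M zero j * det (λ i → removeAt (M (suc i)) j))

  TriangularSupport : (m : ℕ) .{{_ : NonZero m}} → (ℕ → ℤ → Carrier) → Set ℓ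
  TriangularSupport m λ₁ =
    ∀ n k → k ℤ.< + 0 ⊎ k ℤ.> + w m n → λ₁ n k ≈ 0#

  -- The entry a_{ij} for one-based i and j.  The subtraction n ∸ (j ∸ 1) * m
  -- is never truncated when 1 ≤ j ≤ k ≤ w m n.
  entry : (m n : ℕ) (λ₁ : ℕ → ℤ → Carrier) → ℕ → ℕ → Carrier
  entry m n λ₁ i j with j ℕ.≤? i ℕ.+ 1
  ... | yes _ = λ₁ (n ℕ.∸ (j ℕ.∸ 1) ℕ.* m) (+ i ℤ.- + j ℤ.+ + 1)
  ... | no  _ = 0#

  A : (m n : ℕ) (λ₁ : ℕ → ℤ → Carrier) (k : ℕ) → Matrix k
  A m n λ₁ k i j = entry m n λ₁ (suc (toℕ i)) (suc (toℕ j))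

{-# OPTIONS --safe #-}
-- The conditions on λ₃(n,0), …, λ₃(n,k) form a lower triangular linear system.
-- Eliminating one unknown at a time replaces the first two columns of the
-- Hessenberg matrix by a linear combination of them; expanding the determinant
-- along the first row has the same effect, because that row has only two nonzero
-- entries and the determinant is linear in the first column.
module Submission where

open import Algebra.Bundles using (CommutativeRing)
import Algebra.Properties.CommutativeMonoid as CommutativeMonoidProperties
import Algebra.Properties.Ring as RingProperties
import Algebra.Properties.Semiring.Sum as SemiringSum
import Algebra.Solver.Ring.NaturalCoefficients.Default as SemiringSolver
open import Data.Fin.Base using (Fin; zero; suc; toℕ; punchIn)
open import Data.Fin.Properties using (toℕ≤pred[n]; toℕ<n)
open import Data.Integer.Base as ℤ using (ℤ; +_)
import Data.Integer.Properties as ℤ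
open import Data.Nat.Base as ℕ using (ℕ; zero; suc; NonZero; _≤_; _<_; z≤n; s≤s; _∸_)
import Data.Nat.Properties as ℕ
open import Data.Product.Base using (Σ-syntax; _,_; proj₁; proj₂)
open import Data.Vec.Functional using (removeAt)
open import Function.Base using (_∘_)
open import Relation.Binary.PropositionalEquality as ≡ using (_≡_)
import Relation.Binary.Reasoning.Setoid as SetoidReasoning
open import Relation.Nullary.Decidable using (yes; no)
open import Defs

-- Differences of naturals as integers

[1+i]-[1+j]+1≡i+1∸j : ∀ i j → j ≤ i ℕ.+ 1 →
  + suc i ℤ.- + suc j ℤ.+ + 1 ≡ + (i ℕ.+ 1 ∸ j)
[1+i]-[1+j]+1≡i+1∸j i j j≤i+1 = begin
  + suc i ℤ.- + suc j ℤ.+ + 1  ≡⟨ ≡.cong (ℤ._+ + 1) (ℤ.m-n≡m⊖n (suc i) (suc j)) ⟩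
  suc i ℤ.⊖ suc j ℤ.+ + 1      ≡⟨ ℤ.distribˡ-⊖-+-pos 1 (suc i) (suc j) ⟩
  suc (i ℕ.+ 1) ℤ.⊖ suc j      ≡⟨ ℤ.⊖-≥ (s≤s j≤i+1) ⟩
  + (i ℕ.+ 1 ∸ j)              ∎
  where open ≡.≡-Reasoning

+m-+n≡+[m∸n] : ∀ {m n} → n ≤ m → + m ℤ.- + n ≡ + (m ∸ n)
+m-+n≡+[m∸n] {m} {n} n≤m = ≡.trans (ℤ.m-n≡m⊖n m n) (ℤ.⊖-≥ n≤m)

module Hessenberg {c ℓ} (R : CommutativeRing c ℓ) where

  open CommutativeRing R hiding (zero)
  open RingDefs R
  open RingProperties ring
  open SemiringSum semiring
    using (sum; sum-cong-≋; sum-replicate-zero; *-distribˡ-sum)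
  open CommutativeMonoidProperties *-commutativeMonoid
    using (invertibleʳ⇒invertible)
  open SemiringSolver commutativeSemiring using (solve; _:+_; _:*_; _:=_; con)
  open SetoidReasoning setoid

  -- Sums, products, signs and units

  sum-zero : ∀ {n} (f : Fin n → Carrier) → (∀ i → f i ≈ 0#) → sum f ≈ 0#
  sum-zero {n} f f≈0 = trans (sum-cong-≋ f≈0) (sum-replicate-zero n)

  product-cong : ∀ {n} {f g : Fin n → Carrier} → (∀ i → f i ≈ g i) → product f ≈ product g
  product-cong {zero}  f≈g = refl
  product-cong {suc n} f≈g = *-cong (f≈g zero) (product-cong (f≈g ∘ suc))

  product-neg : ∀ {n} (f : Fin n → Carrier) →
    product (λ i → - f i) ≈ (- 1#) ^ n * product f
  product-neg {zero}  f = sym (*-identityˡ 1#)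
  product-neg {suc n} f = begin
    - f zero * product (λ i → - f (suc i))
      ≈⟨ *-cong (sym (-1*x≈-x (f zero))) (product-neg (f ∘ suc)) ⟩
    - 1# * f zero * ((- 1#) ^ n * product (f ∘ suc))
      ≈⟨ solve 4 (λ e x s p → e :* x :* (s :* p) := e :* s :* (x :* p))
           refl (- 1#) (f zero) ((- 1#) ^ n) (product (f ∘ suc)) ⟩
    - 1# * (- 1#) ^ n * (f zero * product (f ∘ suc)) ∎

  -1^n*-1^n≈1 : ∀ n → (- 1#) ^ n * (- 1#) ^ n ≈ 1#
  -1^n*-1^n≈1 zero    = *-identityˡ 1#
  -1^n*-1^n≈1 (suc n) = begin
    - 1# * s * (- 1# * s)    ≈⟨ solve 2 (λ e s → e :* s :* (e :* s) := e :* e :* (s :* s)) refl (- 1#) s ⟩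
    - 1# * - 1# * (s * s)    ≈⟨ *-cong (trans (-1*x≈-x (- 1#)) (-‿involutive 1#)) (-1^n*-1^n≈1 n) ⟩
    1# * 1#                  ≈⟨ *-identityˡ 1# ⟩
    1#                       ∎
    where s = (- 1#) ^ n

  product-isUnit : ∀ {n} (f : Fin n → Carrier) → (∀ i → IsUnit (f i)) → IsUnit (product f)
  product-isUnit {zero}  f u = 1# , *-identityˡ 1# , *-identityˡ 1#
  product-isUnit {suc n} f u = invertibleʳ⇒invertible (x⁻¹ * y⁻¹ , (begin
    f zero * product (f ∘ suc) * (x⁻¹ * y⁻¹)
      ≈⟨ solve 4 (λ x y z w → x :* y :* (z :* w) := x :* z :* (y :* w))
           refl (f zero) (product (f ∘ suc)) x⁻¹ y⁻¹ ⟩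
    f zero * x⁻¹ * (product (f ∘ suc) * y⁻¹)
      ≈⟨ *-cong (proj₂ (proj₂ (u zero))) (proj₂ (proj₂ v)) ⟩
    1# * 1#  ≈⟨ *-identityˡ 1# ⟩
    1#       ∎))
    where
    v = product-isUnit (f ∘ suc) (u ∘ suc)
    x⁻¹ = proj₁ (u zero)
    y⁻¹ = proj₁ v

  -- Determinants of Hessenberg matrices

  minor : ∀ {k} → Matrix (suc k) → Fin (suc k) → Matrix k
  minor M j i = removeAt (M (suc i)) j

  det-cong : ∀ {k} (M N : Matrix k) → (∀ i j → M i j ≈ N i j) → det M ≈ det N
  det-cong {zero}  M N M≈N = refl
  det-cong {suc k} M N M≈N = sum-cong-≋ {suc k} λ j →
    *-cong (*-congˡ {(- 1#) ^ toℕ j} (M≈N zero j))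
      (det-cong (minor M j) (minor N j) λ i l → M≈N (suc i) (punchIn j l))

  -- Recursion in step on both arguments lets a column stripped of its top zero reduce to a shift by
  -- one less. Minors of a Hessenberg matrix can then be compared entrywise by `refl`.
  shiftBy : ℕ → (ℕ → Carrier) → ℕ → Carrier
  shiftBy zero    q i       = q i
  shiftBy (suc j) q zero    = 0#
  shiftBy (suc j) q (suc i) = shiftBy j q i

  shiftBy-≤ : ∀ {j i} q → j ≤ i → shiftBy j q i ≡ q (i ∸ j)
  shiftBy-≤ q z≤n       = ≡.refl
  shiftBy-≤ q (s≤s j≤i) = shiftBy-≤ q j≤i

  shiftBy-> : ∀ {j i} q → i < j → shiftBy j q i ≡ 0#
  shiftBy-> {suc j} {zero}  q _         = ≡.refl
  shiftBy-> {suc j} {suc i} q (s≤s i<j) = shiftBy-> q i<j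

  -- c is column 0, and a j 0, a j 1, … is column j + 1 read downwards from its
  -- superdiagonal entry.
  hessenberg : (ℕ → Carrier) → (ℕ → ℕ → Carrier) → ∀ {k} → Matrix k
  hessenberg c a i zero    = c (toℕ i)
  hessenberg c a i (suc j) = shiftBy (toℕ j) (a (toℕ j)) (toℕ i)

  -- The first row is `c 0`, `a 0 0`, then zeros. Deleting it with column 0 makes the rest of column
  -- 1 the new first column; deleting it with column 1 keeps the rest of column 0. Both minors are
  -- again Hessenberg, with later columns `a ∘ suc`.
  det-hessenberg : ∀ k c a →
    det {2 ℕ.+ k} (hessenberg c a) ≈
    c 0 * det {suc k} (hessenberg (a 0 ∘ suc) (a ∘ suc)) +
    - a 0 0 * det {suc k} (hessenberg (c ∘ suc) (a ∘ suc))
  det-hessenberg k c a = +-cong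
    (*-cong (*-identityˡ (c 0))
      (det-cong (minor M zero) (hessenberg (a 0 ∘ suc) (a ∘ suc))
        λ { i zero → refl ; i (suc j) → refl }))
    (trans
      (+-cong
        (*-cong
          (trans (*-congʳ (*-identityʳ (- 1#))) (-1*x≈-x (a 0 0)))
          (det-cong (minor M (suc zero)) (hessenberg (c ∘ suc) (a ∘ suc))
            λ { i zero → refl ; i (suc j) → refl }))
        (sum-zero {k} (λ j → (- 1#) ^ toℕ (suc (suc j)) * 0# * det (minor M (suc (suc j))))
          λ j → trans (*-congʳ (zeroʳ _)) (zeroˡ _)))
      (+-identityʳ _))
    where
    M : Matrix (2 ℕ.+ k)
    M = hessenberg c a

  -- By induction along `det-hessenberg`: the minor `E` does not involve column 0, and the other
  -- minor has the same linear combination, one row lower, as its first column.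
  det-hessenberg-linear : ∀ k u v c d a →
    det {suc k} (hessenberg (λ i → u * c i + v * d i) a) ≈
    u * det {suc k} (hessenberg c a) + v * det {suc k} (hessenberg d a)
  det-hessenberg-linear zero u v c d a =
    solve 4 (λ u v x y →
        con 1 :* (u :* x :+ v :* y) :* con 1 :+ con 0 :=
        u :* (con 1 :* x :* con 1 :+ con 0) :+ v :* (con 1 :* y :* con 1 :+ con 0))
      refl u v (c 0) (d 0)
  det-hessenberg-linear (suc k) u v c d a = begin
    det {2 ℕ.+ k} (hessenberg (λ i → u * c i + v * d i) a)
      ≈⟨ det-hessenberg k _ a ⟩
    (u * c 0 + v * d 0) * E + p * det {suc k} (hessenberg (λ i → u * c (suc i) + v * d (suc i)) a′)
      ≈⟨ +-congˡ (*-congˡ (det-hessenberg-linear k u v (c ∘ suc) (d ∘ suc) a′)) ⟩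
    (u * c 0 + v * d 0) * E + p * (u * X + v * Y)
      ≈⟨ solve 8 (λ u v x y e p X Y →
             (u :* x :+ v :* y) :* e :+ p :* (u :* X :+ v :* Y) :=
             u :* (x :* e :+ p :* X) :+ v :* (y :* e :+ p :* Y))
           refl u v (c 0) (d 0) E p X Y ⟩
    u * (c 0 * E + p * X) + v * (d 0 * E + p * Y)
      ≈⟨ +-cong (*-congˡ (det-hessenberg k c a)) (*-congˡ (det-hessenberg k d a)) ⟨
    u * det {2 ℕ.+ k} (hessenberg c a) + v * det {2 ℕ.+ k} (hessenberg d a) ∎
    where
    a′ = a ∘ suc
    p = - a 0 0
    E = det {suc k} (hessenberg (a 0 ∘ suc) a′)
    X = det {suc k} (hessenberg (c ∘ suc) a′)
    Y = det {suc k} (hessenberg (d ∘ suc) a′)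

  -- Elimination in the triangular system

  -- Solves the equation at `t = 0`, whose one-term sum unfolds with a trailing `0#`.
  u+[y*z+0]≈0⇒y*-z≈u : ∀ u y z → u + (y * z + 0#) ≈ 0# → y * - z ≈ u
  u+[y*z+0]≈0⇒y*-z≈u u y z eq = begin
    y * - z    ≈⟨ -‿distribʳ-* y z ⟨
    - (y * z)  ≈⟨ +-inverseˡ-unique _ _ (trans (+-congˡ (sym (+-identityʳ _))) eq) ⟨
    u          ∎

  -- Cramer's rule with denominators cleared. The remaining equations are multiplied by the pivot
  -- `- a 0 0` rather than divided by it, so the pivots accumulate in the product on the left.
  hessenberg-solution : ∀ k c a (x : ℕ → Carrier) →
    (∀ t → t < k →
      x 0 * c t + ∑[ b ≤ t ] (x (suc (toℕ b)) * a (toℕ b) (t ∸ toℕ b)) ≈ 0#) →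
    x k * product {k} (λ i → - a (toℕ i) 0) ≈ x 0 * det {k} (hessenberg c a)
  hessenberg-solution zero c a x eqs = refl
  -- Size 1 is a separate base case because `det-hessenberg` starts at size 2.
  hessenberg-solution (suc zero) c a x eqs = begin
    x 1 * (- a 0 0 * 1#)          ≈⟨ *-congˡ (*-identityʳ _) ⟩
    x 1 * - a 0 0                 ≈⟨ u+[y*z+0]≈0⇒y*-z≈u _ _ _ (eqs 0 (s≤s z≤n)) ⟩
    x 0 * c 0                     ≈⟨ solve 2 (λ x y → x :* y := x :* (con 1 :* y :* con 1 :+ con 0)) refl (x 0) (c 0) ⟩
    x 0 * (1# * c 0 * 1# + 0#)    ∎
  hessenberg-solution (suc (suc k)) c a x eqs = begin
    x (2 ℕ.+ k) * (p * P)
      ≈⟨ solve 3 (λ x p P → x :* (p :* P) := p :* x :* P) refl (x (2 ℕ.+ k)) p P ⟩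
    p * x (2 ℕ.+ k) * P
      ≈⟨ hessenberg-solution (suc k) c′ (a ∘ suc) x′ eqs′ ⟩
    x 0 * det {suc k} (hessenberg c′ (a ∘ suc))
      ≈⟨ *-congˡ (det-hessenberg-linear k (c 0) p (a 0 ∘ suc) (c ∘ suc) (a ∘ suc)) ⟩
    x 0 * (c 0 * det {suc k} (hessenberg (a 0 ∘ suc) (a ∘ suc)) +
           p * det {suc k} (hessenberg (c ∘ suc) (a ∘ suc)))
      ≈⟨ *-congˡ (det-hessenberg k c a) ⟨
    x 0 * det {2 ℕ.+ k} (hessenberg c a) ∎
    where
    p = - a 0 0
    P = product {suc k} (λ i → - a (suc (toℕ i)) 0)

    -- This is exactly the combination of the first two columns, below their top entries, that
    -- `det-hessenberg` yields by linearity.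
    c′ : ℕ → Carrier
    c′ t = c 0 * a 0 (suc t) + p * c (suc t)

    -- `x 1` is eliminated. The later unknowns absorb the factor `p`; `x 0` stays unscaled because
    -- its factor already sits in `c′`.
    x′ : ℕ → Carrier
    x′ zero    = x 0
    x′ (suc b) = p * x (2 ℕ.+ b)

    eqs′ : ∀ t → t < suc k →
      x 0 * c′ t + ∑[ b ≤ t ] (x′ (suc (toℕ b)) * a (suc (toℕ b)) (t ∸ toℕ b)) ≈ 0#
    eqs′ t t<1+k = begin
      x 0 * (c 0 * e + p * f) + ∑[ b ≤ t ] (p * x (2 ℕ.+ toℕ b) * a (suc (toℕ b)) (t ∸ toℕ b))
        ≈⟨ +-congˡ (sum-cong-≋ {suc t} λ b → *-assoc p (x (2 ℕ.+ toℕ b)) (a (suc (toℕ b)) (t ∸ toℕ b))) ⟩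
      x 0 * (c 0 * e + p * f) + ∑[ b ≤ t ] (p * s b)
        ≈⟨ +-congˡ (*-distribˡ-sum p s) ⟨
      x 0 * (c 0 * e + p * f) + p * sum s
        ≈⟨ solve 6 (λ x₀ c₀ e p f S →
               x₀ :* (c₀ :* e :+ p :* f) :+ p :* S :=
               x₀ :* c₀ :* e :+ p :* (x₀ :* f :+ S))
             refl (x 0) (c 0) e p f (sum s) ⟩
      x 0 * c 0 * e + p * (x 0 * f + sum s)
        -- The equation at `t = 0` reads `x 1 * p ≈ x 0 * c 0`. Restoring `x 1` exhibits the left
        -- side as `p` times the old equation at `suc t`.
        ≈⟨ +-congʳ (*-congʳ (u+[y*z+0]≈0⇒y*-z≈u _ _ _ (eqs 0 (s≤s z≤n)))) ⟨
      x 1 * p * e + p * (x 0 * f + sum s)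
        ≈⟨ solve 6 (λ x₁ p e x₀ f S →
               x₁ :* p :* e :+ p :* (x₀ :* f :+ S) :=
               p :* (x₀ :* f :+ (x₁ :* e :+ S)))
             refl (x 1) p e (x 0) f (sum s) ⟩
      p * (x 0 * f + (x 1 * e + sum s))
        ≈⟨ *-congˡ (eqs (suc t) (s≤s t<1+k)) ⟩
      p * 0#  ≈⟨ zeroʳ p ⟩
      0#      ∎
      where
      e = a 0 (suc t)
      f = c (suc t)
      s : Fin (suc t) → Carrier
      s b = x (2 ℕ.+ toℕ b) * a (suc (toℕ b)) (t ∸ toℕ b)

  -- The matrix `A` in Hessenberg form

  module _ (m n : ℕ) (λ₁ : ℕ → ℤ → Carrier) where

    firstColumn : ℕ → Carrier
    firstColumn q = λ₁ n (+ suc q)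

    laterColumns : ℕ → ℕ → Carrier
    laterColumns j q = λ₁ (n ∸ suc j ℕ.* m) (+ q)

    -- With zero-based indices the second argument of `λ₁` becomes `i + 1` in column 0 and `i ∸ j`
    -- in column `j + 1`. The test in `entry` then separates the same cases as `shiftBy-≤` and
    -- `shiftBy->`; it never fails in column 0.
    A≈hessenberg : ∀ {k} (i j : Fin k) →
      A m n λ₁ k i j ≈ hessenberg firstColumn laterColumns i j
    A≈hessenberg i j with suc (toℕ j) ℕ.≤? suc (toℕ i) ℕ.+ 1
    A≈hessenberg i zero    | yes (s≤s j≤i+1) = reflexive (≡.cong (λ₁ n)
      (≡.trans ([1+i]-[1+j]+1≡i+1∸j (toℕ i) 0 j≤i+1) (≡.cong +_ (ℕ.+-comm (toℕ i) 1))))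
    A≈hessenberg i (suc j) | yes (s≤s 1+j≤i+1) = reflexive (≡.trans
      (≡.cong (λ₁ _) (≡.trans ([1+i]-[1+j]+1≡i+1∸j (toℕ i) (suc (toℕ j)) 1+j≤i+1)
        (≡.cong (λ r → + (r ∸ suc (toℕ j))) (ℕ.+-comm (toℕ i) 1))))
      (≡.sym (shiftBy-≤ (laterColumns (toℕ j))
        (ℕ.s≤s⁻¹ (≡.subst (suc (toℕ j) ≤_) (ℕ.+-comm (toℕ i) 1) 1+j≤i+1)))))
    A≈hessenberg i zero    | no ≰ with () ← ≰ (s≤s z≤n)
    A≈hessenberg i (suc j) | no ≰ = reflexive (≡.sym
      (shiftBy-> (laterColumns (toℕ j)) (ℕ.≰⇒> λ j≤i → ≰ (s≤s
        (≡.subst (suc (toℕ j) ≤_) (ℕ.+-comm 1 (toℕ i)) (s≤s j≤i))))))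

theorem2p13 :
    ∀ {c ℓ} (R : CommutativeRing c ℓ) →
    let open CommutativeRing R
        open RingDefs R
    in
    (m : ℕ) .{{_ : NonZero m}} (n : ℕ)
    (λ₁ : ℕ → ℤ → Carrier) → TriangularSupport m λ₁ →
    -- λ₃ k stands for λ₃(n,k); only the values with k ≤ w m n are ever used,
    -- and for those indices no subtraction ∸ below is truncated.
    (λ₃ : ℕ → Carrier) →
    (∀ t → 1 ≤ t → t ≤ w m n →
      ∑[ b ≤ t ] (λ₃ (toℕ b) * λ₁ (n ℕ.∸ m ℕ.* toℕ b) (+ t ℤ.- + toℕ b)) ≈ 0#) →
    λ₁ n (+ 0) * λ₃ 0 ≈ 1# →
    (∀ i → 1 ≤ i → i ≤ w m n → IsUnit (λ₁ (n ℕ.∸ i ℕ.* m) (+ 0))) →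
    ∀ k → 1 ≤ k → k ≤ w m n →
    let denominator = ∏[ i ≤ k ] (λ₁ (n ℕ.∸ toℕ i ℕ.* m) (+ 0)) in
    Σ[ unit ∈ IsUnit denominator ]
      λ₃ k ≈ (- 1#) ^ k * (det (A m n λ₁ k) ÷ denominator [ unit ])
theorem2p13 R m n λ₁ _ λ₃ convolution l*λ₃0≈1 units k _ k≤w = denominatorUnit , (begin
    λ₃ k
      ≈⟨ solve 1 (λ x → x := con 1 :* con 1 :* x) refl (λ₃ k) ⟩
    1# * 1# * λ₃ k
      -- One copy of `s` will turn `P` into the product of the pivots, the other is the sign of the
      -- result. The denominator unfolds to `l * P`, its factor at `i = 0` split off.
      ≈⟨ *-congʳ (*-cong (-1^n*-1^n≈1 k) (proj₂ (proj₂ denominatorUnit))) ⟨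
    (s * s) * (l * P * d⁻¹) * λ₃ k
      ≈⟨ solve 5 (λ s l P d x → s :* s :* (l :* P :* d) :* x :=
                                s :* (l :* (x :* (s :* P)) :* d))
           refl s l P d⁻¹ (λ₃ k) ⟩
    s * (l * (λ₃ k * (s * P)) * d⁻¹)
      ≈⟨ *-congˡ (*-congʳ (*-congˡ (*-congˡ (product-neg {k} diagonal)))) ⟨
    s * (l * (λ₃ k * product (λ i → - diagonal i)) * d⁻¹)
      ≈⟨ *-congˡ (*-congʳ (*-congˡ
           (hessenberg-solution k (firstColumn m n λ₁) (laterColumns m n λ₁) λ₃ equations))) ⟩
    s * (l * (λ₃ 0 * H) * d⁻¹)
      -- The split-off factor `l` cancels the `λ₃ 0` left by the elimination.
      ≈⟨ *-congˡ (*-congʳ (trans (sym (*-assoc l _ _)) (*-congʳ l*λ₃0≈1))) ⟩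
    s * (1# * H * d⁻¹)
      ≈⟨ *-congˡ (*-congʳ (trans (*-identityˡ H)
           (det-cong {k} (hessenberg (firstColumn m n λ₁) (laterColumns m n λ₁)) (A m n λ₁ k)
             λ i j → sym (A≈hessenberg m n λ₁ i j)))) ⟩
    s * (det (A m n λ₁ k) * d⁻¹) ∎)
  where
  open CommutativeRing R hiding (zero)
  open RingDefs R
  open Hessenberg R
  open CommutativeMonoidProperties *-commutativeMonoid using (invertibleʳ⇒invertible)
  open SemiringSum semiring using (sum-cong-≋)
  open SemiringSolver commutativeSemiring using (solve; _:*_; _:=_; con)
  open SetoidReasoning setoid

  l = λ₁ n (+ 0)
  s = (- 1#) ^ k

  diagonal : Fin k → Carrier
  diagonal i = λ₁ (n ∸ suc (toℕ i) ℕ.* m) (+ 0)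

  P = product diagonal
  H = det {k} (hessenberg (firstColumn m n λ₁) (laterColumns m n λ₁))

  denominatorUnit : IsUnit (∏[ i ≤ k ] (λ₁ (n ∸ toℕ i ℕ.* m) (+ 0)))
  denominatorUnit = product-isUnit {suc k} (λ i → λ₁ (n ∸ toℕ i ℕ.* m) (+ 0)) λ
    -- Hypothesis (b) supplies `λ₃ 0` as inverse of the factor at `i = 0`; hypothesis (c) covers the
    -- others.
    { zero    → invertibleʳ⇒invertible (λ₃ 0 , l*λ₃0≈1)
    ; (suc i) → units (suc (toℕ i)) (s≤s z≤n) (ℕ.≤-trans (toℕ<n i) k≤w)
    }

  d⁻¹ = proj₁ denominatorUnit

  equations : ∀ t → t < k →
    λ₃ 0 * firstColumn m n λ₁ t +
    ∑[ b ≤ t ] (λ₃ (suc (toℕ b)) * laterColumns m n λ₁ (toℕ b) (t ∸ toℕ b)) ≈ 0#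
  -- Equation `t` is hypothesis (a) at `suc t`, with the term `b = 0` of its sum standing apart as
  -- the constant column.
  equations t t<k = trans
    (+-cong
      (*-congˡ (reflexive (≡.cong₂ λ₁ (≡.cong (n ∸_) (≡.sym (ℕ.*-zeroʳ m)))
        (≡.sym (+m-+n≡+[m∸n] {suc t} z≤n)))))
      (sum-cong-≋ {suc t} λ b → *-congˡ {λ₃ (suc (toℕ b))} (reflexive (≡.cong₂ λ₁
        (≡.cong (n ∸_) (ℕ.*-comm (suc (toℕ b)) m))
        (≡.sym (+m-+n≡+[m∸n] (s≤s (toℕ≤pred[n] b))))))))
    (convolution (suc t) (s≤s z≤n) (ℕ.≤-trans t<k k≤w))
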